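{- Every LTL-satisfiable $\mathrm{THT}^{1}(\mathsf X,\mathsf R)$ formula has a minimal LTL model. Likewise, every LTL-satisfiable $\mathrm{THT}_1$ formula has a minimal LTL model.
   Context: Fix a finite set $P$ of atomic propositions. Formulas over $P$: $\varphi ::= p \mid \bot \mid \varphi\vee\varphi \mid \varphi\wedge\varphi \mid \varphi\rightarrow\varphi \mid \mathsf{X}\varphi \mid \varphi\,\mathsf{U}\,\varphi \mid \varphi\,\mathsf{R}\,\varphi$, with $\neg\varphi:=\varphi\rightarrow\bot$, and the modalities $\mathsf F\varphi$ and $\mathsf G\varphi$ with the meaning of $\top\mathsf U\varphi$ and $\bot\mathsf R\varphi$. An LTL interpretation is an infinite word $T$ over $2^P$. $T\models_{LTL}\varphi$ denotes standard LTL satisfaction at position $0$ (classical implication). A formula is LTL-satisfiable if it has an LTL model. For LTL interpretations, $H\sqsubset T$ means $H(i)\subseteq T(i)$ for all $i$ and $H\ne T$. A minimal LTL model of $\varphi$ is an LTL model $T$ of $\varphi$ such that no $H\sqsubset T$ satisfies $H\models_{LTL}\varphi$. $\mathrm{THT}^{1}(\mathsf X,\mathsf R)$ is the set of formulas whose only temporal modalities are $\mathsf X$ and $\mathsf R$ and whose implication height (maximal nesting of $\rightarrow$, with negation counting as an implication) is at most $1$. $\mathrm{THT}_1$ is the set of formulas (all modalities $\mathsf X,\mathsf U,\mathsf R,\mathsf F,\mathsf G$ allowed) with no nesting of temporal modalities. -}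

module Defs where

open import Data.Empty using (⊥)
open import Data.Fin.Base using (Fin)
open import Data.Fin.Subset using (Subset; _∈_; _⊆_)
open import Data.Nat.Base using (ℕ; zero; suc; _⊔_; _≤_; _<_)
open import Data.Product.Base using (_×_; ∃-syntax)
open import Data.Sum.Base using (_⊎_)
open import Data.Unit.Base using (⊤)
open import Relation.Binary.PropositionalEquality using (_≗_)
open import Relation.Nullary.Negation using (¬_)

infixr 7 _∧′_
infixr 6 _∨′_
infixr 5 _⇒_
infix  8 _U_ _R_

-- The finite set of atomic propositions is Fin n, with n arbitrary.
data Formula (n : ℕ) : Set where
  atom : Fin n → Formula n
  ⊥′   : Formula n
  _∨′_ _∧′_ _⇒_ : Formula n → Formula n → Formula n
  X    : Formula n → Formula n
  _U_ _R_ : Formula n → Formula n → Formula n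

¬′_ : ∀ {n} → Formula n → Formula n
¬′ φ = φ ⇒ ⊥′

⊤′ : ∀ {n} → Formula n
⊤′ = ¬′ ⊥′

-- F and G are abbreviations; each counts as one temporal modality, as
-- neither ⊤′ nor ⊥′ contains any.
F G : ∀ {n} → Formula n → Formula n
F φ = ⊤′ U φ
G φ = ⊥′ R φ

Interpretation : ℕ → Set
Interpretation n = ℕ → Subset n

infix 4 _,_⊨_ _⊨_ _⊑_ _⊏_

_,_⊨_ : ∀ {n} → Interpretation n → ℕ → Formula n → Set
T , i ⊨ atom p   = p ∈ T i
T , i ⊨ ⊥′       = ⊥
T , i ⊨ (φ ∨′ ψ) = T , i ⊨ φ ⊎ T , i ⊨ ψ
T , i ⊨ (φ ∧′ ψ) = T , i ⊨ φ × T , i ⊨ ψ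
T , i ⊨ (φ ⇒ ψ)  = T , i ⊨ φ → T , i ⊨ ψ
T , i ⊨ X φ      = T , suc i ⊨ φ
T , i ⊨ (φ U ψ)  = ∃[ j ] i ≤ j × T , j ⊨ ψ × (∀ k → i ≤ k → k < j → T , k ⊨ φ)
T , i ⊨ (φ R ψ)  = ∀ j → i ≤ j → T , j ⊨ ψ ⊎ (∃[ k ] i ≤ k × k < j × T , k ⊨ φ)

_⊨_ : ∀ {n} → Interpretation n → Formula n → Set
T ⊨ φ = T , 0 ⊨ φ

Satisfiable : ∀ {n} → Formula n → Set
Satisfiable {n} φ = ∃[ T ] T ⊨ φ

_⊑_ : ∀ {n} → Interpretation n → Interpretation n → Set
H ⊑ T = ∀ i → H i ⊆ T i

-- Equality of infinite words is pointwise: function extensionality is not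
-- available for _≡_.
_⊏_ : ∀ {n} → Interpretation n → Interpretation n → Set
H ⊏ T = H ⊑ T × ¬ (H ≗ T)

MinimalModel : ∀ {n} → Interpretation n → Formula n → Set
MinimalModel T φ = T ⊨ φ × (∀ H → H ⊏ T → ¬ (H ⊨ φ))

implicationHeight : ∀ {n} → Formula n → ℕ
implicationHeight (atom p) = 0
implicationHeight ⊥′       = 0
implicationHeight (φ ∨′ ψ) = implicationHeight φ ⊔ implicationHeight ψ
implicationHeight (φ ∧′ ψ) = implicationHeight φ ⊔ implicationHeight ψ
implicationHeight (φ ⇒ ψ)  = suc (implicationHeight φ ⊔ implicationHeight ψ)
implicationHeight (X φ)    = implicationHeight φ
implicationHeight (φ U ψ)  = implicationHeight φ ⊔ implicationHeight ψ
implicationHeight (φ R ψ)  = implicationHeight φ ⊔ implicationHeight ψ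

temporalHeight : ∀ {n} → Formula n → ℕ
temporalHeight (atom p) = 0
temporalHeight ⊥′       = 0
temporalHeight (φ ∨′ ψ) = temporalHeight φ ⊔ temporalHeight ψ
temporalHeight (φ ∧′ ψ) = temporalHeight φ ⊔ temporalHeight ψ
temporalHeight (φ ⇒ ψ)  = temporalHeight φ ⊔ temporalHeight ψ
temporalHeight (X φ)    = suc (temporalHeight φ)
temporalHeight (φ U ψ)  = suc (temporalHeight φ ⊔ temporalHeight ψ)
temporalHeight (φ R ψ)  = suc (temporalHeight φ ⊔ temporalHeight ψ)

OnlyXR : ∀ {n} → Formula n → Set
OnlyXR (atom p) = ⊤
OnlyXR ⊥′       = ⊤
OnlyXR (φ ∨′ ψ) = OnlyXR φ × OnlyXR ψ
OnlyXR (φ ∧′ ψ) = OnlyXR φ × OnlyXR ψ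
OnlyXR (φ ⇒ ψ)  = OnlyXR φ × OnlyXR ψ
OnlyXR (X φ)    = OnlyXR φ
OnlyXR (φ U ψ)  = ⊥
OnlyXR (φ R ψ)  = OnlyXR φ × OnlyXR ψ

THT¹XR : ∀ {n} → Formula n → Set
THT¹XR φ = OnlyXR φ × implicationHeight φ ≤ 1

THT₁ : ∀ {n} → Formula n → Set
THT₁ φ = temporalHeight φ ≤ 1

{-# OPTIONS --safe #-}
-- Greedy minimisation: going through the positions k = 0, 1, 2, …, replace the
-- current model by a smaller one whose letter at k is as small as possible.
-- This never changes an earlier letter again, so the models converge to a limit
-- that lies above no other model; it is minimal as soon as it is a model.
--
-- For THT¹(X, R) the limit is a model: implication-free formulas are monotone,
-- so the premise of an implication that holds in the limit holds along the
-- whole sequence, and X, R, ∧ and ∨ pass to limits by the pigeonhole principle.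
--
-- A THT₁ formula is a finite disjunction of conditions "Q and every letter
-- satisfies d" where Q is open, i.e. settled by a finite prefix.  For such a
-- condition, minimise every letter beyond the prefix subject to d; then finitely
-- many greedy steps on the prefix reach a minimal model.  Having a minimal model
-- below every model is preserved by finite disjunction.
module Submission where

open import Axiom.ExcludedMiddle using (ExcludedMiddle)
open import Data.Fin.Subset using (Subset; _∈_; _⊆_; _⊂_)
open import Data.Fin.Subset.Induction using (⊂-wellFounded)
open import Data.Fin.Subset.Properties using (_∈?_; ⊆-antisym; ⊆-refl; ⊆-reflexive; ⊆-trans)
open import Data.Nat.Base using (ℕ; zero; suc; _⊔_; _≤_; _<_; z≤n; s≤s)
open import Data.Nat.Properties
  using (≤-refl; ≤-trans; <-trans; <-≤-trans; n<1+n; n≮0; _<?_; ≮⇒≥; m≤n⇒m≤1+n;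
         m≤n⇒m<n∨m≡n; m<1+n⇒m<n∨m≡n; m≤m⊔n; m≤n⊔m; m⊔n≤o⇒m≤o; m⊔n≤o⇒n≤o)
open import Data.Product.Base using (_×_; _,_; proj₁; proj₂; ∃-syntax)
open import Data.Sum.Base using (_⊎_; inj₁; inj₂; [_,_]′) renaming (map to ⊎-map)
open import Data.Unit.Base using (⊤; tt)
open import Function.Base using (id; _∘_)
open import Induction.WellFounded using (Acc; acc)
open import Level using (0ℓ)
open import Relation.Binary.PropositionalEquality using (_≡_; _≗_; refl; sym; trans; subst)
open import Relation.Nullary.Decidable.Core using (yes; no; decidable-stable)
open import Relation.Nullary.Negation using (¬_; contradiction)
open import Defs

-- Pointwise order, minimality, monotonicity and locality.

⊑-refl : ∀ {n} {T : Interpretation n} → T ⊑ T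
⊑-refl i = id

⊑-trans : ∀ {n} {S T V : Interpretation n} → S ⊑ T → T ⊑ V → S ⊑ V
⊑-trans S⊑T T⊑V i = T⊑V i ∘ S⊑T i

⊑-antisym : ∀ {n} {S T : Interpretation n} → S ⊑ T → T ⊑ S → S ≗ T
⊑-antisym S⊑T T⊑S i = ⊆-antisym (S⊑T i) (T⊑S i)

≗⇒⊑ : ∀ {n} {S T : Interpretation n} → S ≗ T → S ⊑ T
≗⇒⊑ S≗T i = ⊆-reflexive (S≗T i)

Property : ℕ → Set₁
Property n = Interpretation n → Set

IsMinimal : ∀ {n} → Property n → Property n
IsMinimal P T = P T × (∀ H → H ⊑ T → P H → H ≗ T)

Founded : ∀ {n} → Property n → Set
Founded P = ∀ T → P T → ∃[ S ] S ⊑ T × IsMinimal P S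

Founded⇒minimalModel : ∀ {n} (φ : Formula n) → Founded (_⊨ φ) →
  Satisfiable φ → ∃[ T ] MinimalModel T φ
Founded⇒minimalModel φ founded (T , T⊨φ) with founded T T⊨φ
... | S , _ , S⊨φ , minimal =
  S , S⊨φ , λ H (H⊑S , H≢S) H⊨φ → H≢S (minimal H H⊑S H⊨φ)

-- Height 0 excludes `_⇒_`, the only connective that is not monotone in its arguments.
⊨-monotone : ∀ {n} (φ : Formula n) → implicationHeight φ ≤ 0 →
  ∀ {S T} → S ⊑ T → ∀ i → S , i ⊨ φ → T , i ⊨ φ
⊨-monotone (atom p) _ S⊑T i = S⊑T i
⊨-monotone (φ ∨′ ψ) h S⊑T i = ⊎-map
  (⊨-monotone φ (m⊔n≤o⇒m≤o _ _ h) S⊑T i) (⊨-monotone ψ (m⊔n≤o⇒n≤o _ _ h) S⊑T i)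
⊨-monotone (φ ∧′ ψ) h S⊑T i (x , y) =
  ⊨-monotone φ (m⊔n≤o⇒m≤o _ _ h) S⊑T i x , ⊨-monotone ψ (m⊔n≤o⇒n≤o _ _ h) S⊑T i y
⊨-monotone (X φ) h S⊑T i = ⊨-monotone φ h S⊑T (suc i)
⊨-monotone (φ U ψ) h S⊑T i (j , i≤j , x , before) =
  j , i≤j , ⊨-monotone ψ (m⊔n≤o⇒n≤o _ _ h) S⊑T j x ,
  λ k i≤k k<j → ⊨-monotone φ (m⊔n≤o⇒m≤o _ _ h) S⊑T k (before k i≤k k<j)
⊨-monotone (φ R ψ) h S⊑T i r j i≤j = ⊎-map
  (⊨-monotone ψ (m⊔n≤o⇒n≤o _ _ h) S⊑T j)
  (λ (k , i≤k , k<j , x) → k , i≤k , k<j , ⊨-monotone φ (m⊔n≤o⇒m≤o _ _ h) S⊑T k x)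
  (r j i≤j)

-- Both the word and the position may change, so a formula without modalities can be evaluated on a
-- constant word; this is what makes `Letter` adequate.
⊨-local : ∀ {n} (φ : Formula n) → temporalHeight φ ≤ 0 →
  ∀ {S T : Interpretation n} {i j} → S i ≡ T j → S , i ⊨ φ → T , j ⊨ φ
⊨-local (atom p) _ eq = subst (p ∈_) eq
⊨-local (φ ∨′ ψ) h eq = ⊎-map
  (⊨-local φ (m⊔n≤o⇒m≤o _ _ h) eq) (⊨-local ψ (m⊔n≤o⇒n≤o _ _ h) eq)
⊨-local (φ ∧′ ψ) h eq (x , y) =
  ⊨-local φ (m⊔n≤o⇒m≤o _ _ h) eq x , ⊨-local ψ (m⊔n≤o⇒n≤o _ _ h) eq y
⊨-local (φ ⇒ ψ) h eq f =
  ⊨-local ψ (m⊔n≤o⇒n≤o _ _ h) eq ∘ f ∘ ⊨-local φ (m⊔n≤o⇒m≤o _ _ h) (sym eq)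

-- Infinite recurrence, open properties and normal forms.

Frequently : (ℕ → Set) → Set
Frequently P = ∀ m → ∃[ k ] m ≤ k × P k

Frequently-map : ∀ {P Q : ℕ → Set} → (∀ k → P k → Q k) → Frequently P → Frequently Q
Frequently-map f often m with often m
... | k , m≤k , p = k , m≤k , f k p

-- `_U_` and `_R_` at position 0 over arbitrary predicates on letters, so that negations can be
-- pushed onto the letters.
Until Release : ∀ {n} → (Subset n → Set) → (Subset n → Set) → Property n
Until   a b T = ∃[ j ] b (T j) × (∀ k → k < j → a (T k))
Release a b T = ∀ j → b (T j) ⊎ (∃[ k ] k < j × a (T k))

-- Openness in the product topology on infinite words over discrete letters.
Open : ∀ {n} → Property n → Set
Open Q = ∀ T → Q T → ∃[ N ] ∀ H → (∀ i → i < N → H i ≡ T i) → Q H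

Open-× : ∀ {n} {P Q : Property n} → Open P → Open Q → Open (λ T → P T × Q T)
Open-× P-open Q-open T (p , q) with P-open T p | Q-open T q
... | M , P-near | N , Q-near = M ⊔ N , λ H eq →
  P-near H (λ i i<M → eq i (<-≤-trans i<M (m≤m⊔n M N))) ,
  Q-near H (λ i i<N → eq i (<-≤-trans i<N (m≤n⊔m M N)))

Open-letter : ∀ {n} (d : Subset n → Set) i → Open (λ T → d (T i))
Open-letter d i T x = suc i , λ H eq → subst d (sym (eq i (n<1+n i))) x

Open-Until : ∀ {n} (a b : Subset n → Set) → Open (Until a b)
Open-Until a b T (j , x , before) = suc j , λ H eq →
  j , subst b (sym (eq j (n<1+n j))) x ,
  λ k k<j → subst a (sym (eq k (<-trans k<j (n<1+n j)))) (before k k<j)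

data Normal {n} : Property n → Set₁ where
  basic : ∀ {Q} → Open Q → (d : Subset n → Set) → Normal (λ T → Q T × (∀ i → d (T i)))
  union : ∀ {P Q} → Normal P → Normal Q → Normal (λ T → P T ⊎ Q T)
  equiv : ∀ {P Q} → (∀ T → P T → Q T) → (∀ T → Q T → P T) → Normal P → Normal Q

Normal-open : ∀ {n} {Q : Property n} → Open Q → Normal Q
Normal-open Q-open =
  equiv (λ _ → proj₁) (λ _ q → q , λ _ → tt) (basic Q-open (λ _ → ⊤))

Normal-always : ∀ {n} (d : Subset n → Set) → Normal (λ T → ∀ i → d (T i))
Normal-always d =
  equiv (λ _ → proj₂) (λ _ x → tt , x) (basic (λ _ _ → 0 , λ _ _ → tt) d)

-- Conjunction distributes over unions; two basic conditions merge because open properties intersect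
-- and letterwise conditions combine at each position.
Normal-× : ∀ {n} {P Q : Property n} → Normal P → Normal Q → Normal (λ T → P T × Q T)
Normal-× (equiv f g u) v =
  equiv (λ T (p , q) → f T p , q) (λ T (p , q) → g T p , q) (Normal-× u v)
Normal-× (union u u′) v = equiv
  (λ T → [ (λ (p , q) → inj₁ p , q) , (λ (p , q) → inj₂ p , q) ]′)
  (λ { T (inj₁ p , q) → inj₁ (p , q) ; T (inj₂ p , q) → inj₂ (p , q) })
  (union (Normal-× u v) (Normal-× u′ v))
Normal-× u@(basic _ _) (equiv f g v) =
  equiv (λ T (p , q) → p , f T q) (λ T (p , q) → p , g T q) (Normal-× u v)
Normal-× u@(basic _ _) (union v v′) = equiv
  (λ T → [ (λ (p , q) → p , inj₁ q) , (λ (p , q) → p , inj₂ q) ]′)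
  (λ { T (p , inj₁ q) → inj₁ (p , q) ; T (p , inj₂ q) → inj₂ (p , q) })
  (union (Normal-× u v) (Normal-× u v′))
Normal-× (basic P-open d) (basic Q-open e) = equiv
  (λ T ((p , q) , x) → (p , proj₁ ∘ x) , (q , proj₂ ∘ x))
  (λ T ((p , x) , (q , y)) → (p , q) , λ i → x i , y i)
  (basic (Open-× P-open Q-open) (λ s → d s × e s))

-- Classical pigeonhole principles and minimal letters.

module Classical (em : ExcludedMiddle 0ℓ) where

  stable : {A : Set} → ¬ ¬ A → A
  stable = decidable-stable em

  ¬∀⇒∃¬ : ∀ {A : Set} {P : A → Set} → ¬ (∀ x → P x) → ∃[ x ] ¬ P x
  ¬∀⇒∃¬ ¬all = stable λ ¬some → ¬all λ x → stable λ ¬p → ¬some (x , ¬p)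

  -- If `P` fails from some `M` on, every hit beyond `M` is a hit of `Q`.
  Frequently-⊎ : ∀ {P Q : ℕ → Set} → Frequently (λ k → P k ⊎ Q k) →
    Frequently P ⊎ Frequently Q
  Frequently-⊎ {P} {Q} often with em {Frequently P}
  ... | yes oftenP = inj₁ oftenP
  ... | no ¬oftenP with ¬∀⇒∃¬ ¬oftenP
  ...   | M , never = inj₂ oftenQ
    where
    oftenQ : Frequently Q
    oftenQ m with often (m ⊔ M)
    ... | k , le , inj₁ p = contradiction (k , ≤-trans (m≤n⊔m m M) le , p) never
    ... | k , le , inj₂ q = k , ≤-trans (m≤m⊔n m M) le , q

  -- Only finitely many values lie below `j`, so one of them recurs. This handles the witnesses of
  -- `_R_`, which may vary from stage to stage.
  Frequently-bounded : ∀ (P : ℕ → ℕ → Set) j →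
    Frequently (λ l → ∃[ k ] k < j × P k l) → ∃[ k ] k < j × Frequently (P k)
  Frequently-bounded P zero often with often 0
  ... | _ , _ , _ , k<0 , _ = contradiction k<0 n≮0
  Frequently-bounded P (suc j) often with Frequently-⊎ (Frequently-map split often)
    where
    split : ∀ l → (∃[ k ] k < suc j × P k l) → (∃[ k ] k < j × P k l) ⊎ P j l
    split l (k , k<1+j , p) with m<1+n⇒m<n∨m≡n k<1+j
    ... | inj₁ k<j  = inj₁ (k , k<j , p)
    ... | inj₂ refl = inj₂ p
  ... | inj₂ oftenⱼ = j , n<1+n j , oftenⱼ
  ... | inj₁ often< with Frequently-bounded P j often<
  ...   | k , k<j , oftenₖ = k , <-trans k<j (n<1+n j) , oftenₖ

  minimalSubset : ∀ {n} (d : Subset n → Set) s → d s →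
    ∃[ r ] r ⊆ s × d r × (∀ q → q ⊆ r → d q → q ≡ r)
  minimalSubset d s = go s (⊂-wellFounded s)
    where
    go : ∀ s → Acc _⊂_ s → d s → ∃[ r ] r ⊆ s × d r × (∀ q → q ⊆ r → d q → q ≡ r)
    go s (acc rec) ds with em {∃[ q ] q ⊂ s × d q}
    ... | yes (q , q⊂s , dq) with go q (rec q⊂s) dq
    ...   | r , r⊆q , dr , minimal = r , ⊆-trans r⊆q (proj₁ q⊂s) , dr , minimal
    go s (acc rec) ds | no ¬smaller = s , ⊆-refl , ds , λ q q⊆s dq →
      -- An element of `s` missing from `q` would make `q` a proper subset satisfying `d`.
      ⊆-antisym q⊆s λ {x} x∈s → decidable-stable (x ∈? q) λ x∉q →
        ¬smaller (q , (q⊆s , x , x∈s , x∉q) , dq)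

  -- Greedy minimisation and its limit.

  module Greedy {n} (P : Property n) (T₀ : Interpretation n) (P₀ : P T₀) where

    minimiseAt : ∀ k T → P T →
      ∃[ S ] S ⊑ T × P S × (∀ H → H ⊑ S → P H → H k ≡ S k)
    minimiseAt k T PT
      -- What is minimised is a letter: the predicate asks for some model below `T` that carries it
      -- at `k`.
      with minimalSubset (λ s → ∃[ S ] S ⊑ T × P S × S k ≡ s) (T k) (T , ⊑-refl , PT , refl)
    ... | _ , _ , (S , S⊑T , PS , refl) , minimal = S , S⊑T , PS , λ H H⊑S PH →
      minimal (H k) (H⊑S k) (H , ⊑-trans H⊑S S⊑T , PH , refl)

    chain : ℕ → ∃[ T ] P T
    chain zero = T₀ , P₀
    chain (suc k) with chain k
    ... | T , PT with minimiseAt k T PT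
    ...   | S , _ , PS , _ = S , PS

    stage : ℕ → Interpretation n
    stage k = proj₁ (chain k)

    stage-P : ∀ k → P (stage k)
    stage-P k = proj₂ (chain k)

    stage-step : ∀ k → stage (suc k) ⊑ stage k
    stage-step k with chain k
    ... | T , PT with minimiseAt k T PT
    ...   | _ , S⊑T , _ = S⊑T

    stage-minimalAt : ∀ k H → H ⊑ stage (suc k) → P H → H k ≡ stage (suc k) k
    stage-minimalAt k with chain k
    ... | T , PT with minimiseAt k T PT
    ...   | _ , _ , _ , minimal = minimal

    stage-antitone : ∀ {j k} → j ≤ k → stage k ⊑ stage j
    stage-antitone {k = zero} z≤n = ⊑-refl
    stage-antitone {k = suc k} j≤1+k with m≤n⇒m<n∨m≡n j≤1+k
    ... | inj₁ (s≤s j≤k) = ⊑-trans (stage-step k) (stage-antitone j≤k)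
    ... | inj₂ refl      = ⊑-refl

    stage-minimal : ∀ {i k} → i < k → ∀ H → H ⊑ stage k → P H → H i ≡ stage (suc i) i
    stage-minimal i<k H H⊑ PH = stage-minimalAt _ H (⊑-trans H⊑ (stage-antitone i<k)) PH

    -- Every later stage is itself a model below stage `suc i`, so the minimality at `i` applies to
    -- it.
    stage-stable : ∀ {i k} → i < k → stage k i ≡ stage (suc i) i
    stage-stable {k = k} i<k = stage-minimal i<k (stage k) ⊑-refl (stage-P k)

    limit : Interpretation n
    limit i = stage (suc i) i

    -- Letters before `k` are settled by stage `k`; the others are taken from later stages, which
    -- lie below it.
    limit⊑stage : ∀ k → limit ⊑ stage k
    limit⊑stage k i with i <? k
    ... | yes i<k = ⊆-reflexive (sym (stage-stable i<k))
    ... | no  i≮k = stage-antitone (m≤n⇒m≤1+n (≮⇒≥ i≮k)) i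

    limit-minimal : ∀ H → H ⊑ limit → P H → H ≗ limit
    limit-minimal H H⊑ PH i =
      stage-minimalAt i H (⊑-trans H⊑ (limit⊑stage (suc i))) PH

    -- The induction assumes truth infinitely often rather than always: a disjunction true at all
    -- stages may alternate between its disjuncts, but one of them recurs. `_U_` is excluded, as its
    -- witnesses could escape to infinity.
    limit-⊨ : ∀ (φ : Formula n) → THT¹XR φ → ∀ i →
      Frequently (λ k → stage k , i ⊨ φ) → limit , i ⊨ φ
    -- Any stage beyond `i` already has the letter of the limit at `i`.
    limit-⊨ (atom p) _ i often with often (suc i)
    ... | k , i<k , x = subst (p ∈_) (stage-stable i<k) x
    limit-⊨ ⊥′ _ i often = proj₂ (proj₂ (often 0))
    limit-⊨ (φ ∨′ ψ) ((xr , xr′) , h) i often = ⊎-map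
      (limit-⊨ φ (xr , m⊔n≤o⇒m≤o _ _ h) i) (limit-⊨ ψ (xr′ , m⊔n≤o⇒n≤o _ _ h) i)
      (Frequently-⊎ often)
    limit-⊨ (φ ∧′ ψ) ((xr , xr′) , h) i often =
      limit-⊨ φ (xr , m⊔n≤o⇒m≤o _ _ h) i (Frequently-map (λ _ → proj₁) often) ,
      limit-⊨ ψ (xr′ , m⊔n≤o⇒n≤o _ _ h) i (Frequently-map (λ _ → proj₂) often)
    limit-⊨ (φ ⇒ ψ) ((_ , xr′) , s≤s h) i often x =
      limit-⊨ ψ (xr′ , m≤n⇒m≤1+n (m⊔n≤o⇒n≤o _ _ h)) i (Frequently-map
        (λ k f → f (⊨-monotone φ (m⊔n≤o⇒m≤o _ _ h) (limit⊑stage k) i x)) often)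
    limit-⊨ (X φ) xr i = limit-⊨ φ xr (suc i)
    limit-⊨ (φ R ψ) ((xr , xr′) , h) i often j i≤j
      with Frequently-⊎ (Frequently-map (λ _ r → r j i≤j) often)
    ... | inj₁ oftenψ = inj₁ (limit-⊨ ψ (xr′ , m⊔n≤o⇒n≤o _ _ h) j oftenψ)
    ... | inj₂ oftenφ
      -- The releasing position depends on the stage but stays below `j`, so a single `k` serves
      -- infinitely many stages.
      with Frequently-bounded (λ k l → i ≤ k × stage l , k ⊨ φ) j
             (Frequently-map (λ _ (k , i≤k , k<j , x) → k , k<j , i≤k , x) oftenφ)
    ...   | k , k<j , oftenₖ = inj₂ (k , proj₁ (proj₂ (proj₂ (oftenₖ 0))) , k<j ,
      limit-⊨ φ (xr , m⊔n≤o⇒m≤o _ _ h) k (Frequently-map (λ _ → proj₂) oftenₖ))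

  Founded-THT¹XR : ∀ {n} (φ : Formula n) → THT¹XR φ → Founded (_⊨ φ)
  Founded-THT¹XR φ xr T T⊨φ =
    limit , limit⊑stage 0 ,
    limit-⊨ φ xr 0 (λ m → m , ≤-refl , stage-P m) , limit-minimal
    where open Greedy (_⊨ φ) T T⊨φ

  -- Minimal models for normal forms.

  Founded-⊎ : ∀ {n} {P Q : Property n} → Founded P → Founded Q →
    Founded (λ T → P T ⊎ Q T)
  Founded-⊎ {n} {P} {Q} foundedP foundedQ = λ
    { T (inj₁ p) → go P Q inj₁ inj₂ id foundedP foundedQ T p
    ; T (inj₂ q) → go Q P inj₂ inj₁ [ inj₂ , inj₁ ]′ foundedQ foundedP T q }
    where
    -- A Q-minimal model below a P-minimal one S is also P-minimal, since the
    -- only P-model below S is S itself.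
    go : ∀ {W : Property n} (P Q : Property n) →
      (∀ {T} → P T → W T) → (∀ {T} → Q T → W T) → (∀ {T} → W T → P T ⊎ Q T) →
      Founded P → Founded Q → ∀ T → P T → ∃[ S ] S ⊑ T × IsMinimal W S
    go P Q P⇒W Q⇒W split foundedP foundedQ T p with foundedP T p
    ... | S , S⊑T , PS , minP with em {∃[ H ] H ⊑ S × Q H}
    ...   | no ¬below = S , S⊑T , P⇒W PS , λ H H⊑S w →
      [ minP H H⊑S , (λ q → contradiction (H , H⊑S , q) ¬below) ]′ (split w)
    ...   | yes (H , H⊑S , QH) with foundedQ H QH
    ...     | K , K⊑H , QK , minQ = K , ⊑-trans K⊑S S⊑T , Q⇒W QK , λ L L⊑K w →
      [ (λ p′ → ⊑-antisym L⊑K (⊑-trans K⊑S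
          (≗⇒⊑ (λ i → sym (minP L (⊑-trans L⊑K K⊑S) p′ i)))))
      , minQ L L⊑K ]′ (split w)
      where
      K⊑S : K ⊑ S
      K⊑S = ⊑-trans K⊑H H⊑S

  -- Shrinking letters beyond `N` preserves `Q`, so they can be minimised independently of each
  -- other. Only `N` letters remain to be settled, hence `stage N` suffices and no limit of an open
  -- property has to be taken.
  Founded-basic : ∀ {n} {Q : Property n} → Open Q → (d : Subset n → Set) →
    Founded (λ T → Q T × (∀ i → d (T i)))
  Founded-basic {n} {Q} Q-open d T (q , dT) with Q-open T q
  ... | N , near = stage N , ⊑-trans stage⊑V V⊑T , stage-P N , minimal
    where
    shrunk : ∀ i → ∃[ r ] r ⊆ T i × d r × (∀ q → q ⊆ r → d q → q ≡ r)
    shrunk i = minimalSubset d (T i) (dT i)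

    V : Interpretation n
    V i with i <? N
    ... | yes _ = T i
    ... | no  _ = proj₁ (shrunk i)

    V⊑T : V ⊑ T
    V⊑T i with i <? N
    ... | yes _ = id
    ... | no  _ = proj₁ (proj₂ (shrunk i))

    V-near : ∀ i → i < N → V i ≡ T i
    V-near i i<N with i <? N
    ... | yes _   = refl
    ... | no  i≮N = contradiction i<N i≮N

    V-d : ∀ i → d (V i)
    V-d i with i <? N
    ... | yes _ = dT i
    ... | no  _ = proj₁ (proj₂ (proj₂ (shrunk i)))

    V-far : ∀ i → ¬ i < N → ∀ H → H ⊑ V → d (H i) → H i ≡ V i
    V-far i i≮N H H⊑V dH with i <? N | H⊑V i
    ... | yes i<N | _  = contradiction i<N i≮N
    ... | no  _   | le = proj₂ (proj₂ (proj₂ (shrunk i))) (H i) le dH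

    open Greedy (λ T → Q T × (∀ i → d (T i))) V (near V V-near , V-d)

    stage⊑V : stage N ⊑ V
    stage⊑V = stage-antitone {k = N} z≤n

    minimal : ∀ H → H ⊑ stage N → Q H × (∀ i → d (H i)) → H ≗ stage N
    minimal H H⊑ PH i with i <? N
    ... | yes i<N = trans (stage-minimal i<N H H⊑ PH) (sym (stage-stable i<N))
    -- Beyond `N` the letters of `V` are minimal for `d`, so both `H` and `stage N` must agree with
    -- `V` there.
    ... | no  i≮N = trans
      (V-far i i≮N H (⊑-trans H⊑ stage⊑V) (proj₂ PH i))
      (sym (V-far i i≮N (stage N) stage⊑V (proj₂ (stage-P N) i)))

  Normal⇒Founded : ∀ {n} {P : Property n} → Normal P → Founded P
  Normal⇒Founded (basic Q-open d) = Founded-basic Q-open d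
  Normal⇒Founded (union u v) = Founded-⊎ (Normal⇒Founded u) (Normal⇒Founded v)
  Normal⇒Founded (equiv f g u) T q with Normal⇒Founded u T (g T q)
  ... | S , S⊑T , p , minimal = S , S⊑T , f S p , λ H H⊑S → minimal H H⊑S ∘ g H

  -- Decomposition of release, and duality with until.

  Release⇒always⊎Until : ∀ {n} (a b : Subset n → Set) T → Release a b T →
    (∀ i → b (T i)) ⊎ Until b (λ s → a s × b s) T
  Release⇒always⊎Until a b T r with em {Until b (λ s → a s × b s) T}
  ... | yes u = inj₂ u
  ... | no ¬u = inj₁ λ i → below (suc i) i (n<1+n i)
    where
    below : ∀ m k → k < m → b (T k)
    below (suc m) k k<1+m with m<1+n⇒m<n∨m≡n k<1+m
    ... | inj₁ k<m = below m k k<m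
    ... | inj₂ refl with r k
    ...   | inj₁ x = x
    ...   | inj₂ (l , l<k , y) =
      -- At `l` the predicate `a` holds, and by induction `b` holds at `l` and before it: exactly
      -- the until that was ruled out.
      contradiction (l , (y , below k l l<k) , λ i i<l → below k i (<-trans i<l l<k)) ¬u

  always⊎Until⇒Release : ∀ {n} (a b : Subset n → Set) T →
    (∀ i → b (T i)) ⊎ Until b (λ s → a s × b s) T → Release a b T
  always⊎Until⇒Release a b T (inj₁ always) j = inj₁ (always j)
  always⊎Until⇒Release a b T (inj₂ (k , (x , y) , before)) j with k <? j
  ... | yes k<j = inj₂ (k , k<j , x)
  ... | no  k≮j with m≤n⇒m<n∨m≡n (≮⇒≥ k≮j)
  ...   | inj₁ j<k  = inj₁ (before j j<k)
  ...   | inj₂ refl = inj₁ y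

  -- Release is either `b` forever, a letterwise condition, or `b` until `a` and `b` together, an
  -- open one.
  Normal-Release : ∀ {n} (a b : Subset n → Set) → Normal (Release a b)
  Normal-Release a b = equiv (always⊎Until⇒Release a b) (Release⇒always⊎Until a b)
    (union (Normal-always b) (Normal-open (Open-Until b (λ s → a s × b s))))

  -- This and the next three lemmas are the until/release dualities, which keep negated modalities
  -- within the normal forms.
  ¬Until⇒Release : ∀ {n} (a b : Subset n → Set) T →
    ¬ Until a b T → Release (¬_ ∘ a) (¬_ ∘ b) T
  ¬Until⇒Release a b T ¬u j with em {b (T j)}
  ... | no ¬x = inj₁ ¬x
  ... | yes x = inj₂ (stable λ ¬some → ¬u (j , x , λ k k<j → stable λ ¬y →
    ¬some (k , k<j , ¬y)))

  Release⇒¬Until : ∀ {n} (a b : Subset n → Set) T →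
    Release (¬_ ∘ a) (¬_ ∘ b) T → ¬ Until a b T
  Release⇒¬Until a b T r (j , x , before) with r j
  ... | inj₁ ¬x = ¬x x
  ... | inj₂ (k , k<j , ¬y) = ¬y (before k k<j)

  ¬Release⇒Until : ∀ {n} (a b : Subset n → Set) T →
    ¬ Release a b T → Until (¬_ ∘ a) (¬_ ∘ b) T
  ¬Release⇒Until a b T ¬r with ¬∀⇒∃¬ ¬r
  ... | j , ¬both = j , ¬both ∘ inj₁ , λ k k<j y → ¬both (inj₂ (k , k<j , y))

  Until⇒¬Release : ∀ {n} (a b : Subset n → Set) T →
    Until (¬_ ∘ a) (¬_ ∘ b) T → ¬ Release a b T
  Until⇒¬Release a b T (j , ¬x , before) r with r j
  ... | inj₁ x = ¬x x
  ... | inj₂ (k , k<j , y) = before k k<j y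

  -- From THT₁ formulas to normal forms.

  Letter : ∀ {n} → Formula n → Subset n → Set
  Letter φ s = (λ _ → s) , 0 ⊨ φ

  toLetter : ∀ {n} (φ : Formula n) → temporalHeight φ ≤ 0 →
    ∀ T i → T , i ⊨ φ → Letter φ (T i)
  toLetter φ h T i = ⊨-local φ h refl

  fromLetter : ∀ {n} (φ : Formula n) → temporalHeight φ ≤ 0 →
    ∀ T i → Letter φ (T i) → T , i ⊨ φ
  fromLetter φ h T i = ⊨-local φ h refl

  module _ {n} (φ ψ : Formula n) (h : temporalHeight φ ⊔ temporalHeight ψ ≤ 0) where

    private
      hφ : temporalHeight φ ≤ 0
      hφ = m⊔n≤o⇒m≤o _ _ h

      hψ : temporalHeight ψ ≤ 0
      hψ = m⊔n≤o⇒n≤o _ _ h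

    U⇒Until : ∀ T → T ⊨ φ U ψ → Until (Letter φ) (Letter ψ) T
    U⇒Until T (j , _ , x , before) =
      j , toLetter ψ hψ T j x , λ k k<j → toLetter φ hφ T k (before k z≤n k<j)

    Until⇒U : ∀ T → Until (Letter φ) (Letter ψ) T → T ⊨ φ U ψ
    Until⇒U T (j , x , before) =
      j , z≤n , fromLetter ψ hψ T j x , λ k _ k<j → fromLetter φ hφ T k (before k k<j)

    R⇒Release : ∀ T → T ⊨ φ R ψ → Release (Letter φ) (Letter ψ) T
    R⇒Release T r j = ⊎-map (toLetter ψ hψ T j)
      (λ (k , _ , k<j , x) → k , k<j , toLetter φ hφ T k x) (r j z≤n)

    Release⇒R : ∀ T → Release (Letter φ) (Letter ψ) T → T ⊨ φ R ψ
    Release⇒R T r j _ = ⊎-map (fromLetter ψ hψ T j)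
      (λ (k , k<j , x) → k , z≤n , k<j , fromLetter φ hφ T k x) (r j)

  -- Normal forms are not visibly closed under complement, so a formula and its negation are treated
  -- together; implication exchanges the two.
  Normal-⊨ : ∀ {n} (φ : Formula n) → THT₁ φ → Normal (_⊨ φ)
  Normal-⊭ : ∀ {n} (φ : Formula n) → THT₁ φ → Normal (λ T → ¬ T ⊨ φ)

  Normal-⊨ (atom p) _ = Normal-open (Open-letter (p ∈_) 0)
  Normal-⊨ ⊥′ _ = Normal-open (λ _ ())
  Normal-⊨ (φ ∨′ ψ) h =
    union (Normal-⊨ φ (m⊔n≤o⇒m≤o _ _ h)) (Normal-⊨ ψ (m⊔n≤o⇒n≤o _ _ h))
  Normal-⊨ (φ ∧′ ψ) h =
    Normal-× (Normal-⊨ φ (m⊔n≤o⇒m≤o _ _ h)) (Normal-⊨ ψ (m⊔n≤o⇒n≤o _ _ h))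
  Normal-⊨ (φ ⇒ ψ) h = equiv
    (λ T → [ (λ ¬x x → contradiction x ¬x) , (λ y _ → y) ]′) to
    (union (Normal-⊭ φ (m⊔n≤o⇒m≤o _ _ h)) (Normal-⊨ ψ (m⊔n≤o⇒n≤o _ _ h)))
    where
    to : ∀ T → T ⊨ φ ⇒ ψ → ¬ T ⊨ φ ⊎ T ⊨ ψ
    to T f with em {T ⊨ φ}
    ... | yes x = inj₂ (f x)
    ... | no ¬x = inj₁ ¬x
  -- The argument of `X` contains no modality, so it only constrains the letter at position 1.
  Normal-⊨ (X φ) (s≤s h) = equiv (λ T → fromLetter φ h T 1) (λ T → toLetter φ h T 1)
    (Normal-open (Open-letter (Letter φ) 1))
  Normal-⊨ (φ U ψ) (s≤s h) = equiv (Until⇒U φ ψ h) (U⇒Until φ ψ h)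
    (Normal-open (Open-Until (Letter φ) (Letter ψ)))
  Normal-⊨ (φ R ψ) (s≤s h) = equiv (Release⇒R φ ψ h) (R⇒Release φ ψ h)
    (Normal-Release (Letter φ) (Letter ψ))

  Normal-⊭ (atom p) _ = Normal-open (Open-letter (λ s → ¬ p ∈ s) 0)
  Normal-⊭ ⊥′ _ = Normal-open (λ _ _ → 0 , λ _ _ → id)
  Normal-⊭ (φ ∨′ ψ) h = equiv
    (λ T (¬x , ¬y) → [ ¬x , ¬y ]′) (λ T ¬xy → ¬xy ∘ inj₁ , ¬xy ∘ inj₂)
    (Normal-× (Normal-⊭ φ (m⊔n≤o⇒m≤o _ _ h)) (Normal-⊭ ψ (m⊔n≤o⇒n≤o _ _ h)))
  Normal-⊭ (φ ∧′ ψ) h = equiv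
    (λ T → [ _∘ proj₁ , _∘ proj₂ ]′) to
    (union (Normal-⊭ φ (m⊔n≤o⇒m≤o _ _ h)) (Normal-⊭ ψ (m⊔n≤o⇒n≤o _ _ h)))
    where
    to : ∀ T → ¬ T ⊨ φ ∧′ ψ → ¬ T ⊨ φ ⊎ ¬ T ⊨ ψ
    to T ¬xy with em {T ⊨ φ}
    ... | yes x = inj₂ (λ y → ¬xy (x , y))
    ... | no ¬x = inj₁ ¬x
  Normal-⊭ (φ ⇒ ψ) h = equiv
    (λ T (x , ¬y) f → ¬y (f x))
    (λ T ¬f → stable (λ ¬x → ¬f (λ x → contradiction x ¬x)) , λ y → ¬f (λ _ → y))
    (Normal-× (Normal-⊨ φ (m⊔n≤o⇒m≤o _ _ h)) (Normal-⊭ ψ (m⊔n≤o⇒n≤o _ _ h)))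
  Normal-⊭ (X φ) (s≤s h) = equiv
    (λ T ¬x → ¬x ∘ toLetter φ h T 1) (λ T ¬x → ¬x ∘ fromLetter φ h T 1)
    (Normal-open (Open-letter (¬_ ∘ Letter φ) 1))
  Normal-⊭ (φ U ψ) (s≤s h) = equiv
    (λ T r → Release⇒¬Until (Letter φ) (Letter ψ) T r ∘ U⇒Until φ ψ h T)
    (λ T ¬u → ¬Until⇒Release (Letter φ) (Letter ψ) T (¬u ∘ Until⇒U φ ψ h T))
    (Normal-Release (¬_ ∘ Letter φ) (¬_ ∘ Letter ψ))
  Normal-⊭ (φ R ψ) (s≤s h) = equiv
    (λ T u → Until⇒¬Release (Letter φ) (Letter ψ) T u ∘ R⇒Release φ ψ h T)
    (λ T ¬r → ¬Release⇒Until (Letter φ) (Letter ψ) T (¬r ∘ Release⇒R φ ψ h T))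
    (Normal-open (Open-Until (¬_ ∘ Letter φ) (¬_ ∘ Letter ψ)))

  Founded-THT₁ : ∀ {n} (φ : Formula n) → THT₁ φ → Founded (_⊨ φ)
  Founded-THT₁ φ h = Normal⇒Founded (Normal-⊨ φ h)

mainTheorem10 : ExcludedMiddle 0ℓ → (n : ℕ) →
    ((φ : Formula n) → THT¹XR φ → Satisfiable φ → ∃[ T ] MinimalModel T φ) ×
    ((φ : Formula n) → THT₁ φ → Satisfiable φ → ∃[ T ] MinimalModel T φ)
mainTheorem10 em n =
  (λ φ xr → Founded⇒minimalModel φ (Founded-THT¹XR φ xr)) ,
  (λ φ h → Founded⇒minimalModel φ (Founded-THT₁ φ h))
  where open Classical em
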